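{- Let $\mathcal S=(S_i)_{i\geqslant 1}$ be a sequence of finite subsets $S_i\subset[-1,1]$ whose growth function $f:\mathbb N_{\geqslant 1}\to\mathbb N_{\geqslant 1}$, $f(i)=|S_i|$, is non-decreasing. For integers $d\geqslant 1$ and $\mu\geqslant 0$ let $\mathrm N_d(\mu)=|\Gamma_d(\mu)|$ be the number of nodes of the Smolyak grid $\Gamma_d(\mu)$, let $\mathcal N_d(\mu)=\sum_{|\mathbf i|=d+\mu}\prod_{k=1}^d f(i_k)$, and define the formal power series $$G_d(x)=\sum_{\mu=0}^\infty \mathrm N_d(\mu)x^\mu,\qquad \mathcal G_d(x)=\sum_{\mu=0}^\infty \mathcal N_d(\mu)x^\mu .$$ Let $$F(x)=\sum_{\ell=0}^\infty f(\ell+1)x^\ell .$$ Then: (i) If $\mathcal S$ is nested, i.e. $S_k\subset S_{k+1}$ for all $k\geqslant 1$, then $G_1(x)=F(x)$ and, for every $d\geqslant 1$, $G_d(x)=G_1(x)^d(1-x)^{d-1}$. (ii) For arbitrary (not necessarily nested) $\mathcal S$, $\mathcal G_1(x)=F(x)$ and, for every $d\geqslant 1$, $\mathcal G_d(x)=\mathcal G_1(x)^d$.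
   Context: For a multi-index $\mathbf i=(i_1,\dots,i_d)\in\mathbb N_{\geqslant 1}^d$ (all entries positive integers), $|\mathbf i|=i_1+\dots+i_d$. Sums and unions over $\mathbf i$ run over $\mathbf i\in\mathbb N_{\geqslant 1}^d$. The Smolyak grid in $d$ dimensions of level $\mu\in\mathbb N=\{0,1,2,\dots\}$ attached to $\mathcal S$ is $$\Gamma_d(\mu)=\bigcup_{\max\{d,\mu+1\}\leqslant|\mathbf i|\leqslant d+\mu}S_{i_1}\times\cdots\times S_{i_d}\subset[-1,1]^d .$$ If $\mathcal S$ is nested, this equals $\bigcup_{|\mathbf i|=d+\mu}S_{i_1}\times\cdots\times S_{i_d}$. -}

module Defs where

open import Algebra.Bundles using (CommutativeRing)
open import Data.Fin.Base using (Fin; toℕ)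
open import Data.Integer.Base as ℤ using (ℤ; 0ℤ; 1ℤ)
open import Data.Integer.Properties using (+-*-commutativeRing)
open import Data.List.Base as List using (List; concatMap; upTo)
open import Data.List.Membership.Propositional using (_∈_; lose; find)
open import Data.List.Membership.Propositional.Properties
  using (∈-map⁺; ∈-map⁻; ∈-concatMap⁺; ∈-concatMap⁻; ∈-upTo⁺; ∈-upTo⁻)
open import Data.List.Relation.Binary.Disjoint.Propositional using (Disjoint)
import Data.List.Relation.Unary.All as All
import Data.List.Relation.Unary.All.Properties as AllP
import Data.List.Relation.Unary.AllPairs as AllPairs
import Data.List.Relation.Unary.AllPairs.Properties as AllPairsP
open import Data.List.Relation.Unary.Any using (here)
open import Data.List.Relation.Unary.Unique.Propositional using (Unique)
import Data.List.Relation.Unary.Unique.Propositional.Properties as UniqueP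
open import Data.Nat.Base as ℕ using (ℕ; zero; suc; NonZero; _⊔_; _∸_)
open import Data.Nat.ListAction using (sum)
import Data.Nat.Properties as ℕ
open import Data.Product.Base using (Σ; ∃-syntax; _×_; _,_; proj₁; proj₂)
open import Data.Rational.Base as ℚ using (ℚ; 1ℚ; ½; Positive)
import Data.Rational.Properties as ℚ
import Data.Rational.Solver as ℚSolver
open import Data.Vec.Base as Vec using (Vec; []; _∷_)
open import Data.Vec.Relation.Binary.Pointwise.Inductive using (Pointwise)
import Data.Vec.Relation.Binary.Equality.Setoid as VecEq
open import Function.Bundles using (Bijection)
open import Level using (0ℓ)
open import Relation.Binary.Bundles using (Setoid)
open import Relation.Binary.Definitions using (_Respects_)
import Relation.Binary.Construct.On as On
open import Relation.Binary.PropositionalEquality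
  using (_≡_; _≢_; refl; sym; trans; cong; subst; setoid)
open import Relation.Unary using (Pred; _⊆_)

-- Real numbers: Cauchy sequences of rationals, with equality "the
-- difference tends to 0" kept as a setoid equality.
record ℝ : Set where
  field
    seq    : ℕ → ℚ
    cauchy : ∀ ε → .{{Positive ε}} → ∃[ n₀ ] ∀ m n → n₀ ℕ.≤ m → n₀ ℕ.≤ n →
             ℚ.∣ seq m ℚ.- seq n ∣ ℚ.≤ ε

open ℝ public using (seq)

infix 4 _≈ℝ_ _≤ℝ_

_≈ℝ_ : ℝ → ℝ → Set
x ≈ℝ y = ∀ ε → .{{Positive ε}} → ∃[ n₀ ] ∀ n → n₀ ℕ.≤ n →
         ℚ.∣ seq x n ℚ.- seq y n ∣ ℚ.≤ ε

_≤ℝ_ : ℝ → ℝ → Set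
x ≤ℝ y = ∀ ε → .{{Positive ε}} → ∃[ n₀ ] ∀ n → n₀ ℕ.≤ n →
         seq x n ℚ.≤ seq y n ℚ.+ ε

private
  ∣p-p∣≤ε : ∀ p ε → .{{Positive ε}} → ℚ.∣ p ℚ.- p ∣ ℚ.≤ ε
  ∣p-p∣≤ε p ε = subst (λ z → ℚ.∣ z ∣ ℚ.≤ ε) (sym (ℚ.+-inverseʳ p))
                      (ℚ.<⇒≤ (ℚ.positive⁻¹ ε))

  ∣p-q∣≡∣q-p∣ : ∀ p q → ℚ.∣ p ℚ.- q ∣ ≡ ℚ.∣ q ℚ.- p ∣
  ∣p-q∣≡∣q-p∣ p q = trans (sym (ℚ.∣-p∣≡∣p∣ (p ℚ.- q))) (cong ℚ.∣_∣
    (solve 2 (λ a b → :- (a :- b) := b :- a) refl p q))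
    where open ℚSolver.+-*-Solver

  halves : ∀ ε → ε ℚ.* ½ ℚ.+ ε ℚ.* ½ ≡ ε
  halves ε = trans (sym (ℚ.*-distribˡ-+ ε ½ ½)) (ℚ.*-identityʳ ε)

  triangle : ∀ p q r → ℚ.∣ p ℚ.- r ∣ ℚ.≤ ℚ.∣ p ℚ.- q ∣ ℚ.+ ℚ.∣ q ℚ.- r ∣
  triangle p q r = subst (λ z → ℚ.∣ z ∣ ℚ.≤ ℚ.∣ p ℚ.- q ∣ ℚ.+ ℚ.∣ q ℚ.- r ∣)
    (solve 3 (λ a b c → (a :- b) :+ (b :- c) := a :- c) refl p q r)
    (ℚ.∣p+q∣≤∣p∣+∣q∣ (p ℚ.- q) (q ℚ.- r))
    where open ℚSolver.+-*-Solver

  ≈ℝ-trans : ∀ {x y z} → x ≈ℝ y → y ≈ℝ z → x ≈ℝ z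
  ≈ℝ-trans {x} {y} {z} x≈y y≈z ε =
    let instance _ = ℚ.pos*pos⇒pos ε ½
        a , p = x≈y (ε ℚ.* ½)
        b , q = y≈z (ε ℚ.* ½)
    in a ⊔ b , λ n a⊔b≤n → subst (ℚ.∣ seq x n ℚ.- seq z n ∣ ℚ.≤_) (halves ε)
         (ℚ.≤-trans (triangle (seq x n) (seq y n) (seq z n))
           (ℚ.+-mono-≤ (p n (ℕ.m⊔n≤o⇒m≤o a b a⊔b≤n))
                       (q n (ℕ.m⊔n≤o⇒n≤o a b a⊔b≤n))))

ℝ-setoid : Setoid 0ℓ 0ℓ
ℝ-setoid = record
  { Carrier       = ℝ
  ; _≈_           = _≈ℝ_
  ; isEquivalence = record
    { refl  = λ {x} ε → 0 , λ n _ → ∣p-p∣≤ε (seq x n) ε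
    ; sym   = λ {x} {y} x≈y ε → proj₁ (x≈y ε) , λ n le →
                subst (ℚ._≤ ε) (∣p-q∣≡∣q-p∣ (seq x n) (seq y n))
                      (proj₂ (x≈y ε) n le)
    ; trans = λ {x} {y} {z} → ≈ℝ-trans {x} {y} {z}
    }
  }

fromℚ : ℚ → ℝ
fromℚ q = record { seq = λ _ → q ; cauchy = λ ε → 0 , λ _ _ _ _ → ∣p-p∣≤ε q ε }

[-1,1] : Pred ℝ 0ℓ
[-1,1] x = fromℚ (ℚ.- 1ℚ) ≤ℝ x × x ≤ℝ fromℚ 1ℚ

ℝ^ : ℕ → Setoid 0ℓ 0ℓ
ℝ^ d = record { isEquivalence = VecEq.≋-isEquivalence ℝ-setoid d }

-- Cardinality of a subset P of a setoid: elements of P are counted up to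
-- the equality of the ambient setoid.
HasCardinality : (A : Setoid 0ℓ 0ℓ) → Pred (Setoid.Carrier A) 0ℓ → ℕ → Set
HasCardinality A P n =
  Bijection (setoid (Fin n)) (On.setoid {B = Σ (Setoid.Carrier A) P} A proj₁)

record ℕ⁺ : Set where
  constructor mkℕ⁺
  field
    value        : ℕ
    .{{nonZero}} : NonZero value

open ℕ⁺ public using (value)

suc⁺ : ℕ → ℕ⁺
suc⁺ n = mkℕ⁺ (suc n)

MultiIndex : ℕ → Set
MultiIndex d = Vec ℕ⁺ d

∥_∥ : ∀ {d} → MultiIndex d → ℕ
∥ i ∥ = Vec.sum (Vec.map value i)

-- All multi-indices i ∈ ℕ≥1^d with ∥ i ∥ ≡ s, each listed exactly once; see
-- ∈-multiIndices⁺, ∈-multiIndices⁻ and multiIndices-unique below.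
multiIndices : ∀ d → ℕ → List (MultiIndex d)
multiIndices zero    zero    = [] List.∷ List.[]
multiIndices zero    (suc _) = List.[]
multiIndices (suc d) s       =
  concatMap (λ k → List.map (suc⁺ k ∷_) (multiIndices d (s ∸ suc k))) (upTo s)

∈-multiIndices⁺ : ∀ {d} (i : MultiIndex d) → i ∈ multiIndices d ∥ i ∥
∈-multiIndices⁺ []                 = here refl
∈-multiIndices⁺ {suc d} (mkℕ⁺ (suc k) ∷ i) =
  ∈-concatMap⁺ _ (lose (∈-upTo⁺ (ℕ.m≤m+n (suc k) ∥ i ∥))
    (∈-map⁺ _ (subst (λ s → i ∈ multiIndices d s)
                     (sym (ℕ.m+n∸m≡n (suc k) ∥ i ∥)) (∈-multiIndices⁺ i))))

∈-multiIndices⁻ : ∀ {d s} {i : MultiIndex d} → i ∈ multiIndices d s → ∥ i ∥ ≡ s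
∈-multiIndices⁻ {zero} {zero} (here refl) = refl
∈-multiIndices⁻ {suc d} {s} i∈
  with k , k∈ , i∈′ ← find (∈-concatMap⁻ _ {xs = upTo s} i∈)
  with j , j∈ , refl ← ∈-map⁻ _ i∈′
  = trans (cong (suc k ℕ.+_) (∈-multiIndices⁻ j∈)) (ℕ.m+[n∸m]≡n (∈-upTo⁻ k∈))

multiIndices-unique : ∀ d s → Unique (multiIndices d s)
multiIndices-unique zero    zero    = All.[] AllPairs.∷ AllPairs.[]
multiIndices-unique zero    (suc _) = AllPairs.[]
multiIndices-unique (suc d) s       = UniqueP.concat⁺
  (AllP.map⁺ (All.tabulate λ {k} _ →
    UniqueP.map⁺ (λ { refl → refl }) (multiIndices-unique d (s ∸ suc k))))
  (AllPairsP.map⁺ (AllPairs.map disjoint (UniqueP.upTo⁺ s)))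
  where
  block : ℕ → List (MultiIndex (suc d))
  block k = List.map (suc⁺ k ∷_) (multiIndices d (s ∸ suc k))

  disjoint : ∀ {k l} → k ≢ l → Disjoint (block k) (block l)
  disjoint k≢l (p , q)
    with _ , _ , refl ← ∈-map⁻ _ p
    with _ , _ , refl ← ∈-map⁻ _ q
    = k≢l refl

record NodeSequence : Set₁ where
  field
    S             : ℕ⁺ → Pred ℝ 0ℓ
    S-resp-≈      : ∀ i → S i Respects _≈ℝ_
    S⊆[-1,1]      : ∀ i → S i ⊆ [-1,1]
    f             : ℕ⁺ → ℕ
    S-cardinality : ∀ i → HasCardinality ℝ-setoid (S i) (f i)
    f-positive    : ∀ i → 1 ℕ.≤ f i
    f-mono        : ∀ i j → value i ℕ.≤ value j → f i ℕ.≤ f j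

open NodeSequence public

Nested : NodeSequence → Set
Nested 𝒮 = ∀ k → S 𝒮 k ⊆ S 𝒮 (suc⁺ (value k))

Γ : NodeSequence → (d μ : ℕ) → Pred (Vec ℝ d) 0ℓ
Γ 𝒮 d μ x = Σ (MultiIndex d) λ i →
  d ⊔ suc μ ℕ.≤ ∥ i ∥ × ∥ i ∥ ℕ.≤ d ℕ.+ μ × Pointwise (S 𝒮) i x

-- N d μ = |Γ_d(μ)| for all d ≥ 1 and μ ≥ 0.  It is a relation because |Γ_d(μ)|
-- cannot be computed from 𝒮 in general, equality of reals being undecidable.
IsNodeCount : NodeSequence → (ℕ → ℕ → ℕ) → Set
IsNodeCount 𝒮 N =
  ∀ d → .{{NonZero d}} → ∀ μ → HasCardinality (ℝ^ d) (Γ 𝒮 d μ) (N d μ)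

𝒩 : NodeSequence → ℕ → ℕ → ℕ
𝒩 𝒮 d μ = sum (List.map (λ i → Vec.foldr′ ℕ._*_ 1 (Vec.map (f 𝒮) i))
                        (multiIndices d (d ℕ.+ μ)))

-- Coefficients lie in ℤ rather than ℕ because of the factor 1 - x.
PowerSeries : Set
PowerSeries = ℕ → ℤ

private
  open import Algebra.Definitions.RawMonoid
    (CommutativeRing.+-rawMonoid +-*-commutativeRing)
    using () renaming (sum to ∑)

infix  4 _≋_
infixl 6 _⊖_
infixl 7 _⊛_
infixr 8 _^_

_≋_ : PowerSeries → PowerSeries → Set
A ≋ B = ∀ n → A n ≡ B n

_⊖_ : PowerSeries → PowerSeries → PowerSeries
(A ⊖ B) n = A n ℤ.- B n

_⊛_ : PowerSeries → PowerSeries → PowerSeries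
(A ⊛ B) n = ∑ {suc n} (λ k → A (toℕ k) ℤ.* B (n ∸ toℕ k))

𝟙 : PowerSeries
𝟙 zero    = 1ℤ
𝟙 (suc _) = 0ℤ

X : PowerSeries
X zero    = 0ℤ
X (suc n) = 𝟙 n

_^_ : PowerSeries → ℕ → PowerSeries
A ^ zero  = 𝟙
A ^ suc n = A ⊛ A ^ n

genFun : (ℕ → ℕ) → PowerSeries
genFun a n = ℤ.+ a n

F : NodeSequence → PowerSeries
F 𝒮 = genFun (λ ℓ → f 𝒮 (suc⁺ ℓ))

{-# OPTIONS --safe #-}
module Submission where

-- Let D = (1 - x) F, whose coefficients f(k+1) - f(k) count the points that are
-- new in S_{k+1}.  In the nested case every point x of some S_k has a first level,
-- so a tuple lies in Γ_d(μ) iff the first levels of its entries, counted from 0,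
-- add up to at most μ.  Splitting by the first level of the first entry gives
-- G_{d+1} = D G_d with G_0 = 1 / (1 - x), whence G_d = F^d (1 - x)^{d-1}.  For the
-- weighted count, splitting by the first index gives 𝒢_{d+1} = F 𝒢_d.
-- Although equality of reals is undecidable, first levels can be computed: the
-- inclusion of S_k in S_{k+1} is a map between finite index sets.

open import Defs
open import Data.Nat.Base using (ℕ; NonZero; _∸_)
open import Data.Product.Base using (∃; _×_)

open import Algebra.Bundles using (CommutativeSemigroup)
import Algebra.Definitions.RawMonoid as Sum
import Algebra.Properties.CommutativeSemigroup as CommutativeSemigroupProperties
open import Data.Fin.Base using (Fin; zero; suc; toℕ; fromℕ<)
import Data.Fin.Properties as Fin
open import Data.Integer.Base as ℤ using (ℤ; 0ℤ; 1ℤ)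
import Data.Integer.Properties as ℤ
open import Data.Integer.Tactic.RingSolver using (solve-∀)
open import Data.List.Base as List using (List; concatMap; applyUpTo; []; _∷_)
open import Data.List.Membership.Propositional using (_∈_)
import Data.List.Properties as List
open import Data.List.Relation.Unary.Any using (here)
open import Data.Nat.Base as ℕ using (zero; suc; s≤s)
open import Data.Nat.ListAction using (sum)
open import Data.Nat.ListAction.Properties using (sum-++)
import Data.Nat.Properties as ℕ
open import Data.Product.Base using (_,_; proj₁; proj₂)
open import Data.Sum.Base using (inj₁; inj₂; [_,_]; [_,_]′)
open import Data.Unit.Base using (⊤; tt)
open import Data.Vec.Base as Vec using (Vec; []; _∷_)
open import Data.Vec.Functional using (Vector)
open import Data.Vec.Relation.Binary.Pointwise.Inductive using (Pointwise; []; _∷_)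
open import Function.Base using (_∘_; id; const)
open import Function.Bundles
  using (Bijection; Injection; Inverse; _↔_; _⇔_; Equivalence; mk⇔)
open import Function.Definitions using (Injective)
open import Function.Properties.Inverse using (↔⇒↣)
open import Level using (0ℓ)
open import Relation.Binary.Bundles using (Setoid)
open import Relation.Binary.Definitions using (_Respects_; tri<; tri≈; tri>)
open import Relation.Binary.PropositionalEquality
  using (_≡_; _≢_; refl; sym; trans; cong; cong₂; subst; _→-setoid_; module ≡-Reasoning)
open import Relation.Nullary using (¬_; Dec; yes; no; contradiction)
open import Relation.Unary using (Pred; _⊆_; _∪_; _∩_; ∁)

open Sum ℕ.+-0-rawMonoid using () renaming (sum to ∑)

open Equivalence using (to; from)

-- Arithmetic of formal power series

tail : PowerSeries → PowerSeries
tail A n = A (suc n)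

⊛-cong : ∀ {A A′ B B′} → A ≋ A′ → B ≋ B′ → A ⊛ B ≋ A′ ⊛ B′
⊛-cong A≋ B≋ zero    = cong₂ (λ a b → a ℤ.* b ℤ.+ 0ℤ) (A≋ 0) (B≋ 0)
⊛-cong A≋ B≋ (suc n) =
  cong₂ ℤ._+_ (cong₂ ℤ._*_ (A≋ 0) (B≋ (suc n))) (⊛-cong (A≋ ∘ suc) B≋ n)

⊛-zeroˡ : ∀ B n → (const 0ℤ ⊛ B) n ≡ 0ℤ
⊛-zeroˡ B zero    = refl
⊛-zeroˡ B (suc n) = trans (ℤ.+-identityˡ _) (⊛-zeroˡ B n)

-- The shape `c * A + B` is that of a shifted product: `tail (A ⊛ B)` unfolds to `A 0` times
-- `tail B` plus `tail A ⊛ B`, which is what associativity has to expand.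
⊛-linearˡ : ∀ c A B C n →
  ((λ k → c ℤ.* A k ℤ.+ B k) ⊛ C) n ≡ c ℤ.* (A ⊛ C) n ℤ.+ (B ⊛ C) n
⊛-linearˡ c A B C zero = lemma c (A 0) (B 0) (C 0)
  where
  lemma : ∀ c a b x → (c ℤ.* a ℤ.+ b) ℤ.* x ℤ.+ 0ℤ ≡
    c ℤ.* (a ℤ.* x ℤ.+ 0ℤ) ℤ.+ (b ℤ.* x ℤ.+ 0ℤ)
  lemma = solve-∀
⊛-linearˡ c A B C (suc n) =
  trans (cong (ℤ._+_ ((c ℤ.* A 0 ℤ.+ B 0) ℤ.* C (suc n))) (⊛-linearˡ c (tail A) (tail B) C n))
        (lemma c (A 0) (B 0) (C (suc n)) _ _)
  where
  lemma : ∀ c a b x p q → (c ℤ.* a ℤ.+ b) ℤ.* x ℤ.+ (c ℤ.* p ℤ.+ q) ≡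
    c ℤ.* (a ℤ.* x ℤ.+ p) ℤ.+ (b ℤ.* x ℤ.+ q)
  lemma = solve-∀

⊛-identityˡ : ∀ A → 𝟙 ⊛ A ≋ A
⊛-identityˡ A zero    = lemma (A 0)
  where
  lemma : ∀ a → 1ℤ ℤ.* a ℤ.+ 0ℤ ≡ a
  lemma = solve-∀
⊛-identityˡ A (suc n) =
  trans (cong₂ ℤ._+_ (ℤ.*-identityˡ (A (suc n))) (⊛-zeroˡ A n)) (ℤ.+-identityʳ _)

-- The definition of ⊛ peels off the constant term of the left factor; this
-- is the mirror image.
⊛-suc : ∀ A B n → (A ⊛ B) (suc n) ≡ A (suc n) ℤ.* B 0 ℤ.+ (A ⊛ tail B) n
⊛-suc A B zero    = lemma (A 0) (B 1) (A 1) (B 0)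
  where
  lemma : ∀ a b c d → a ℤ.* b ℤ.+ (c ℤ.* d ℤ.+ 0ℤ) ≡ c ℤ.* d ℤ.+ (a ℤ.* b ℤ.+ 0ℤ)
  lemma = solve-∀
⊛-suc A B (suc n) =
  trans (cong (ℤ._+_ (A 0 ℤ.* B (suc (suc n)))) (⊛-suc (tail A) B n))
        (lemma (A 0 ℤ.* B (suc (suc n))) (A (suc (suc n)) ℤ.* B 0) _)
  where
  lemma : ∀ x y z → x ℤ.+ (y ℤ.+ z) ≡ y ℤ.+ (x ℤ.+ z)
  lemma = solve-∀

⊛-comm : ∀ A B → A ⊛ B ≋ B ⊛ A
⊛-comm A B zero    = cong (ℤ._+ 0ℤ) (ℤ.*-comm (A 0) (B 0))
⊛-comm A B (suc n) =
  trans (cong₂ ℤ._+_ (ℤ.*-comm (A 0) (B (suc n))) (⊛-comm (tail A) B n))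
        (sym (⊛-suc B A n))

⊛-assoc : ∀ A B C → (A ⊛ B) ⊛ C ≋ A ⊛ (B ⊛ C)
⊛-assoc A B C zero    = lemma (A 0) (B 0) (C 0)
  where
  lemma : ∀ a b c → (a ℤ.* b ℤ.+ 0ℤ) ℤ.* c ℤ.+ 0ℤ ≡ a ℤ.* (b ℤ.* c ℤ.+ 0ℤ) ℤ.+ 0ℤ
  lemma = solve-∀
⊛-assoc A B C (suc n) = begin
  (A 0 ℤ.* B 0 ℤ.+ 0ℤ) ℤ.* C (suc n) ℤ.+ (tail (A ⊛ B) ⊛ C) n
    ≡⟨ cong (ℤ._+_ ((A 0 ℤ.* B 0 ℤ.+ 0ℤ) ℤ.* C (suc n)))
             (⊛-linearˡ (A 0) (tail B) (tail A ⊛ B) C n) ⟩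
  (A 0 ℤ.* B 0 ℤ.+ 0ℤ) ℤ.* C (suc n) ℤ.+
    (A 0 ℤ.* (tail B ⊛ C) n ℤ.+ ((tail A ⊛ B) ⊛ C) n)
    ≡⟨ cong (λ z → (A 0 ℤ.* B 0 ℤ.+ 0ℤ) ℤ.* C (suc n) ℤ.+ (A 0 ℤ.* (tail B ⊛ C) n ℤ.+ z))
             (⊛-assoc (tail A) B C n) ⟩
  (A 0 ℤ.* B 0 ℤ.+ 0ℤ) ℤ.* C (suc n) ℤ.+
    (A 0 ℤ.* (tail B ⊛ C) n ℤ.+ (tail A ⊛ (B ⊛ C)) n)
    ≡⟨ lemma (A 0) (B 0) (C (suc n)) _ _ ⟩
  A 0 ℤ.* (B 0 ℤ.* C (suc n) ℤ.+ (tail B ⊛ C) n) ℤ.+ (tail A ⊛ (B ⊛ C)) n ∎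
  where
  open ≡-Reasoning
  lemma : ∀ a b c p q →
    (a ℤ.* b ℤ.+ 0ℤ) ℤ.* c ℤ.+ (a ℤ.* p ℤ.+ q) ≡ a ℤ.* (b ℤ.* c ℤ.+ p) ℤ.+ q
  lemma = solve-∀

⊛-identityʳ : ∀ A → A ⊛ 𝟙 ≋ A
⊛-identityʳ A n = trans (⊛-comm A 𝟙 n) (⊛-identityˡ A n)

⊛-commutativeSemigroup : CommutativeSemigroup 0ℓ 0ℓ
⊛-commutativeSemigroup = record
  { Carrier = PowerSeries
  ; _≈_ = _≋_
  ; _∙_ = _⊛_
  ; isCommutativeSemigroup = record
    { isSemigroup = record
      { isMagma = record
        { isEquivalence = Setoid.isEquivalence (ℕ →-setoid ℤ)
        ; ∙-cong = ⊛-cong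
        }
      ; assoc = ⊛-assoc
      }
    ; comm = ⊛-comm
    }
  }

open CommutativeSemigroupProperties ⊛-commutativeSemigroup
  using () renaming (interchange to ⊛-interchange)

^-cong : ∀ {A B} d → A ≋ B → A ^ d ≋ B ^ d
^-cong zero    A≋B n = refl
^-cong (suc d) A≋B   = ⊛-cong A≋B (^-cong d A≋B)

[𝟙⊖X]⊛-suc : ∀ A n → ((𝟙 ⊖ X) ⊛ A) (suc n) ≡ A (suc n) ℤ.- A n
[𝟙⊖X]⊛-suc A n = begin
  1ℤ ℤ.* A (suc n) ℤ.+ (tail (𝟙 ⊖ X) ⊛ A) n
    -- The tail of 1 - x is the constant series -1, put in the form that `⊛-linearˡ` accepts.
    ≡⟨ cong (ℤ._+_ (1ℤ ℤ.* A (suc n))) (⊛-cong {B = A} (λ k → lemma₁ (𝟙 k)) (λ _ → refl) n) ⟩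
  1ℤ ℤ.* A (suc n) ℤ.+ ((λ k → ℤ.-1ℤ ℤ.* 𝟙 k ℤ.+ 0ℤ) ⊛ A) n
    ≡⟨ cong (ℤ._+_ (1ℤ ℤ.* A (suc n))) (⊛-linearˡ ℤ.-1ℤ 𝟙 (const 0ℤ) A n) ⟩
  1ℤ ℤ.* A (suc n) ℤ.+ (ℤ.-1ℤ ℤ.* (𝟙 ⊛ A) n ℤ.+ (const 0ℤ ⊛ A) n)
    ≡⟨ cong₂ (λ a b → 1ℤ ℤ.* A (suc n) ℤ.+ (ℤ.-1ℤ ℤ.* a ℤ.+ b))
             (⊛-identityˡ A n) (⊛-zeroˡ A n) ⟩
  1ℤ ℤ.* A (suc n) ℤ.+ (ℤ.-1ℤ ℤ.* A n ℤ.+ 0ℤ)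
    ≡⟨ lemma₂ (A (suc n)) (A n) ⟩
  A (suc n) ℤ.- A n ∎
  where
  open ≡-Reasoning
  lemma₁ : ∀ a → 0ℤ ℤ.- a ≡ ℤ.-1ℤ ℤ.* a ℤ.+ 0ℤ
  lemma₁ = solve-∀
  lemma₂ : ∀ a b → 1ℤ ℤ.* a ℤ.+ (ℤ.-1ℤ ℤ.* b ℤ.+ 0ℤ) ≡ a ℤ.- b
  lemma₂ = solve-∀

-- A factor x^m of `B` passes to the product and can be cancelled. With m = d this converts indexing
-- by `∥ i ∥` into indexing by μ = `∥ i ∥` - d.
⊛-shiftʳ : ∀ m A B → (∀ k → k ℕ.< m → B k ≡ 0ℤ) →
  ∀ n → (A ⊛ B) (m ℕ.+ n) ≡ (A ⊛ (λ k → B (m ℕ.+ k))) n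
⊛-shiftʳ zero    A B B<m≡0 n = refl
⊛-shiftʳ (suc m) A B B<m≡0 n = begin
  (A ⊛ B) (suc m ℕ.+ n)
    ≡⟨ ⊛-suc A B (m ℕ.+ n) ⟩
  A (suc m ℕ.+ n) ℤ.* B 0 ℤ.+ (A ⊛ tail B) (m ℕ.+ n)
    ≡⟨ cong (λ b → A (suc m ℕ.+ n) ℤ.* b ℤ.+ (A ⊛ tail B) (m ℕ.+ n))
             (B<m≡0 0 (s≤s ℕ.z≤n)) ⟩
  A (suc m ℕ.+ n) ℤ.* 0ℤ ℤ.+ (A ⊛ tail B) (m ℕ.+ n)
    ≡⟨ cong (ℤ._+ (A ⊛ tail B) (m ℕ.+ n)) (ℤ.*-zeroʳ (A (suc m ℕ.+ n))) ⟩
  0ℤ ℤ.+ (A ⊛ tail B) (m ℕ.+ n)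
    ≡⟨ ℤ.+-identityˡ _ ⟩
  (A ⊛ tail B) (m ℕ.+ n)
    ≡⟨ ⊛-shiftʳ m A (tail B) (λ k k<m → B<m≡0 (suc k) (s≤s k<m)) n ⟩
  (A ⊛ (λ k → B (suc m ℕ.+ k))) n ∎
  where open ≡-Reasoning

genFun-⊛ : ∀ a b n →
  genFun (λ m → ∑ {suc m} (λ k → a (toℕ k) ℕ.* b (m ∸ toℕ k))) n ≡
  (genFun a ⊛ genFun b) n
genFun-⊛ a b zero    = trans (ℤ.pos-+ (a 0 ℕ.* b 0) 0) (cong (ℤ._+ 0ℤ) (ℤ.pos-* (a 0) (b 0)))
genFun-⊛ a b (suc n) = trans (ℤ.pos-+ (a 0 ℕ.* b (suc n)) _)
  (cong₂ ℤ._+_ (ℤ.pos-* (a 0) (b (suc n))) (genFun-⊛ (a ∘ suc) b n))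

-- Finite subsets of a setoid

-- A subset with n elements, given by mutually inverse maps instead of the
-- bijectivity of one map as in HasCardinality.
record Enumeration (A : Setoid 0ℓ 0ℓ) (P : Pred (Setoid.Carrier A) 0ℓ) (n : ℕ) : Set where
  open Setoid A using (Carrier; _≈_)
  field
    elem           : Fin n → Carrier
    elem∈          : ∀ i → P (elem i)
    elem-injective : Injective _≡_ _≈_ elem
    index          : ∀ {x} → P x → Fin n
    elem-index     : ∀ {x} (p : P x) → elem (index p) ≈ x

  index-injective : ∀ {x y} (p : P x) (q : P y) → index p ≡ index q → x ≈ y
  index-injective p q eq =
    Setoid.trans A (Setoid.sym A (elem-index p))
      (Setoid.trans A (Setoid.reflexive A (cong elem eq)) (elem-index q))

  index-cong : ∀ {x y} (p : P x) (q : P y) → x ≈ y → index p ≡ index q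
  index-cong p q x≈y = elem-injective
    (Setoid.trans A (elem-index p) (Setoid.trans A x≈y (Setoid.sym A (elem-index q))))

open Enumeration

module _ {A : Setoid 0ℓ 0ℓ} where
  open Setoid A using (Carrier; _≈_)
  private module A = Setoid A

  fromHasCardinality : ∀ {P n} → HasCardinality A P n → Enumeration A P n
  fromHasCardinality b = record
    { elem           = λ i → proj₁ (B.to i)
    ; elem∈          = λ i → proj₂ (B.to i)
    ; elem-injective = B.injective
    ; index          = λ p → proj₁ (B.surjective (_ , p))
    ; elem-index     = λ p → proj₂ (B.surjective (_ , p)) refl
    }
    where module B = Bijection b

  toHasCardinality : ∀ {P n} → Enumeration A P n → HasCardinality A P n
  toHasCardinality e = record
    { to        = λ i → elem e i , elem∈ e i
    ; cong      = λ { refl → A.refl }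
    ; bijective = elem-injective e ,
                  λ (_ , p) → index e p , λ { refl → elem-index e p }
    }

  -- Allows an index type other than `Fin n`, so that unions can be indexed by sums and Cartesian
  -- products by pairs.
  reindex : ∀ {P n} {I : Set} → Fin n ↔ I → (g : I → Carrier) → (∀ i → P (g i)) →
    Injective _≡_ _≈_ g → (∀ {x} → P x → ∃ λ i → g i ≈ x) → Enumeration A P n
  reindex φ g g∈ g-injective g-onto = record
    { elem           = g ∘ Inverse.to φ
    ; elem∈          = g∈ ∘ Inverse.to φ
    ; elem-injective = Injection.injective (↔⇒↣ φ) ∘ g-injective
    ; index          = λ p → Inverse.from φ (proj₁ (g-onto p))
    ; elem-index     = λ p → A.trans
        (A.reflexive (cong g (Inverse.strictlyInverseˡ φ (proj₁ (g-onto p)))))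
        (proj₂ (g-onto p))
    }

  ⊆⇒≤ : ∀ {P Q m n} → Enumeration A P m → Enumeration A Q n → P ⊆ Q → m ℕ.≤ n
  ⊆⇒≤ p q P⊆Q = Fin.injective⇒≤ {f = λ i → index q (P⊆Q (elem∈ p i))}
    (λ eq → elem-injective p (index-injective q _ _ eq))

  size-unique : ∀ {P m n} → Enumeration A P m → Enumeration A P n → m ≡ n
  size-unique p q = ℕ.≤-antisym (⊆⇒≤ p q id) (⊆⇒≤ q p id)

  Enumeration-⇔ : ∀ {P Q n} → (∀ {x} → P x ⇔ Q x) → Enumeration A P n → Enumeration A Q n
  Enumeration-⇔ P⇔Q p = record
    { elem           = elem p
    ; elem∈          = λ i → to P⇔Q (elem∈ p i)
    ; elem-injective = elem-injective p
    ; index          = λ q → index p (from P⇔Q q)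
    ; elem-index     = λ q → elem-index p (from P⇔Q q)
    }

  -- Having no common element would be too weak: points are counted up to `≈`, which the predicates
  -- need not respect.
  Apart : Pred Carrier 0ℓ → Pred Carrier 0ℓ → Set
  Apart P Q = ∀ {x y} → P x → Q y → ¬ x ≈ y

  enum-∅ : ∀ {P} → (∀ {x} → ¬ P x) → Enumeration A P 0
  enum-∅ ¬P = record
    { elem           = λ ()
    ; elem∈          = λ ()
    ; elem-injective = λ {}
    ; index          = λ p → contradiction p ¬P
    ; elem-index     = λ p → contradiction p ¬P
    }

  enum-singleton : ∀ {P} x → P x → (∀ {y} → P y → x ≈ y) → Enumeration A P 1
  enum-singleton x Px x≈ = record
    { elem           = λ _ → x
    ; elem∈          = λ _ → Px
    ; elem-injective = λ { {zero} {zero} _ → refl }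
    ; index          = λ _ → zero
    ; elem-index     = x≈
    }

  enum-∪ : ∀ {P Q m n} → Apart P Q → Enumeration A P m → Enumeration A Q n →
    Enumeration A (P ∪ Q) (m ℕ.+ n)
  enum-∪ {P} {Q} apart p q = reindex Fin.+↔⊎ [ elem p , elem q ]′
    [ inj₁ ∘ elem∈ p , inj₂ ∘ elem∈ q ] injective
    λ { (inj₁ Px) → inj₁ (index p Px) , elem-index p Px
      ; (inj₂ Qx) → inj₂ (index q Qx) , elem-index q Qx }
    where
    injective : Injective _≡_ _≈_ [ elem p , elem q ]′
    injective {inj₁ i} {inj₁ j} eq = cong inj₁ (elem-injective p eq)
    injective {inj₁ i} {inj₂ j} eq = contradiction eq (apart (elem∈ p i) (elem∈ q j))
    injective {inj₂ i} {inj₁ j} eq = contradiction (A.sym eq) (apart (elem∈ p j) (elem∈ q i))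
    injective {inj₂ i} {inj₂ j} eq = cong inj₂ (elem-injective q eq)

  enum-⋃ : ∀ {m} {P : Fin m → Pred Carrier 0ℓ} {c : Vector ℕ m} →
    (∀ {i j} → i ≢ j → Apart (P i) (P j)) → (∀ i → Enumeration A (P i) (c i)) →
    Enumeration A (λ x → ∃ λ i → P i x) (∑ c)
  enum-⋃ {zero}  apart p = enum-∅ λ ()
  enum-⋃ {suc m} apart p = Enumeration-⇔
    (mk⇔ [ (zero ,_) , (λ (i , Px) → suc i , Px) ]
         λ { (zero , Px) → inj₁ Px ; (suc i , Px) → inj₂ (i , Px) })
    (enum-∪ (λ Px (i , Py) → apart (λ ()) Px Py) (p zero)
      (enum-⋃ (λ i≢j → apart (i≢j ∘ Fin.suc-injective)) (p ∘ suc)))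

  -- Although ≈ need not be decidable, membership in P of a point of Q is:
  -- compare its index with those of the points of P.
  member? : ∀ {P Q m n} → P Respects _≈_ → P ⊆ Q → Enumeration A P m → Enumeration A Q n →
    ∀ {x} → Q x → Dec (P x)
  member? resp P⊆Q p q Qx with Fin.any? (λ i → index q (P⊆Q (elem∈ p i)) Fin.≟ index q Qx)
  ... | yes (i , eq) = yes (resp (index-injective q _ _ eq) (elem∈ p i))
  ... | no ¬any      = no λ Px →
    ¬any (index p Px , index-cong q _ _ (elem-index p Px))

  -- Each listed point of `Q` contributes an empty piece if it lies in `P` and one `≈`-class
  -- otherwise. The total is not computed directly: `P` and the difference partition `Q`, and sizes
  -- are unique.
  enum-∖ : ∀ {P Q m n} → P Respects _≈_ → P ⊆ Q → Enumeration A P m → Enumeration A Q n →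
    Enumeration A (Q ∩ ∁ P) (n ∸ m)
  enum-∖ {P} {Q} {m} {n} resp P⊆Q p q = subst (Enumeration A (Q ∩ ∁ P)) count≡ Q∖P
    where
    P? = λ j → member? resp P⊆Q p q (elem∈ q j)

    -- `Q x` is a separate clause because only `P` is known to respect `≈`.
    R : Fin n → Pred Carrier 0ℓ
    R j x = Q x × elem q j ≈ x × ¬ P (elem q j)

    enum-R : ∀ j → ∃ (Enumeration A (R j))
    enum-R j with P? j
    ... | yes Pj = 0 , enum-∅ λ (_ , _ , ¬Pj) → ¬Pj Pj
    ... | no ¬Pj = 1 , enum-singleton (elem q j) (elem∈ q j , A.refl , ¬Pj)
                         λ (_ , j≈x , _) → j≈x

    ⋃R⇔Q∖P : ∀ {x} → (∃ λ j → R j x) ⇔ (Q ∩ ∁ P) x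
    ⋃R⇔Q∖P = mk⇔
      (λ (_ , Qx , j≈x , ¬Pj) → Qx , ¬Pj ∘ resp (A.sym j≈x))
      (λ (Qx , ¬Px) → index q Qx , Qx , elem-index q Qx , ¬Px ∘ resp (elem-index q Qx))

    R-apart : ∀ {i j} → i ≢ j → Apart (R i) (R j)
    R-apart i≢j (_ , i≈x , _) (_ , j≈y , _) x≈y =
      i≢j (elem-injective q (A.trans i≈x (A.trans x≈y (A.sym j≈y))))

    Q∖P : Enumeration A (Q ∩ ∁ P) (∑ (proj₁ ∘ enum-R))
    Q∖P = Enumeration-⇔ ⋃R⇔Q∖P (enum-⋃ R-apart (proj₂ ∘ enum-R))

    P∪Q∖P : Enumeration A Q (m ℕ.+ ∑ (proj₁ ∘ enum-R))
    P∪Q∖P = Enumeration-⇔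
      (mk⇔ [ P⊆Q , proj₁ ] split)
      (enum-∪ (λ Px (_ , ¬Py) x≈y → ¬Py (resp x≈y Px)) p Q∖P)
      where
      split : Q ⊆ P ∪ (Q ∩ ∁ P)
      split Qx with member? resp P⊆Q p q Qx
      ... | yes Px = inj₁ Px
      ... | no ¬Px = inj₂ (Qx , ¬Px)

    count≡ : ∑ (proj₁ ∘ enum-R) ≡ n ∸ m
    count≡ = trans (sym (ℕ.m+n∸m≡n m _)) (cong (_∸ m) (size-unique P∪Q∖P q))

-- Products of finite sets of points

_×̇_ : ∀ {d} → Pred ℝ 0ℓ → Pred (Vec ℝ d) 0ℓ → Pred (Vec ℝ (suc d)) 0ℓ
(P ×̇ Q) (x ∷ xs) = P x × Q xs

enum-×̇ : ∀ {d P Q m n} → Enumeration ℝ-setoid P m → Enumeration (ℝ^ d) Q n →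
  Enumeration (ℝ^ (suc d)) (P ×̇ Q) (m ℕ.* n)
enum-×̇ p q = reindex Fin.*↔× (λ (i , j) → elem p i ∷ elem q j)
  (λ (i , j) → elem∈ p i , elem∈ q j)
  (λ { (x≈y ∷ xs≈ys) → cong₂ _,_ (elem-injective p x≈y) (elem-injective q xs≈ys) })
  (λ { {x ∷ xs} (Px , Qxs) → (index p Px , index q Qxs) , elem-index p Px ∷ elem-index q Qxs })

-- Multi-indices

d≤∥i∥ : ∀ {d} (i : MultiIndex d) → d ℕ.≤ ∥ i ∥
d≤∥i∥ []                  = ℕ.z≤n
d≤∥i∥ (mkℕ⁺ (suc k) ∷ i) = s≤s (ℕ.m≤n⇒m≤o+n k (d≤∥i∥ i))

multiIndices-empty : ∀ {d s} → s ℕ.< d → multiIndices d s ≡ []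
multiIndices-empty {d} {s} s<d = lemma (multiIndices d s) λ i i∈ →
  ℕ.<⇒≱ s<d (subst (d ℕ.≤_) (∈-multiIndices⁻ i∈) (d≤∥i∥ i))
  where
  lemma : ∀ (xs : List (MultiIndex d)) → (∀ i → ¬ i ∈ xs) → xs ≡ []
  lemma []       _ = refl
  lemma (x ∷ xs) h = contradiction (here refl) (h x)

-- Smolyak grids of a nested sequence

module _ (𝒮 : NodeSequence) where

  -- Under nestedness, avoiding the preceding set means avoiding all earlier ones, so these are the
  -- points of first level `k`, counted from 0.
  New : ℕ → Pred ℝ 0ℓ
  New zero    = S 𝒮 (suc⁺ 0)
  New (suc k) = S 𝒮 (suc⁺ (suc k)) ∩ ∁ (S 𝒮 (suc⁺ k))

  -- The coefficients of D; truncated subtraction is exact here because `f` is non-decreasing.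
  newCount : ℕ → ℕ
  newCount zero    = f 𝒮 (suc⁺ 0)
  newCount (suc k) = f 𝒮 (suc⁺ (suc k)) ∸ f 𝒮 (suc⁺ k)

  -- Agrees with Γ 𝒮 d μ when 𝒮 is nested and d ≥ 1, but is a disjoint union,
  -- and at d = 0 consists of the empty tuple, whereas Γ 𝒮 0 μ is empty.
  Grid : ∀ d → ℕ → Pred (Vec ℝ d) 0ℓ
  Grid zero    μ x = ⊤
  Grid (suc d) μ x = ∃ λ (k : Fin (suc μ)) → (New (toℕ k) ×̇ Grid d (μ ∸ toℕ k)) x

  -- Follows the recursion of `Grid`. It is a Cauchy product, starting from the coefficients of 1 /
  -- (1 - x).
  gridCount : ℕ → ℕ → ℕ
  gridCount zero    μ = 1
  gridCount (suc d) μ =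
    ∑ {suc μ} (λ k → newCount (toℕ k) ℕ.* gridCount d (μ ∸ toℕ k))

  enum-S : ∀ i → Enumeration ℝ-setoid (S 𝒮 i) (f 𝒮 i)
  enum-S i = fromHasCardinality (S-cardinality 𝒮 i)

  New⊆S : ∀ k → New k ⊆ S 𝒮 (suc⁺ k)
  New⊆S zero    = id
  New⊆S (suc k) = proj₁

  module _ (nested : Nested 𝒮) where

    S-mono : ∀ {j k} → j ℕ.≤′ k → S 𝒮 (suc⁺ j) ⊆ S 𝒮 (suc⁺ k)
    S-mono ℕ.≤′-refl       = id
    S-mono (ℕ.≤′-step j≤k) = nested _ ∘ S-mono j≤k

    enum-New : ∀ k → Enumeration ℝ-setoid (New k) (newCount k)
    enum-New zero    = enum-S (suc⁺ 0)
    enum-New (suc k) = enum-∖ (S-resp-≈ 𝒮 _) (nested _) (enum-S _) (enum-S _)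

    New-apart-< : ∀ {j k} → j ℕ.< k → Apart {ℝ-setoid} (New j) (New k)
    New-apart-< {j} {suc k} (s≤s j≤k) x∈ (_ , y∉) x≈y =
      y∉ (S-resp-≈ 𝒮 (suc⁺ k) x≈y (S-mono (ℕ.≤⇒≤′ j≤k) (New⊆S j x∈)))

    New-apart : ∀ {j k} → j ≢ k → Apart {ℝ-setoid} (New j) (New k)
    New-apart {j} {k} j≢k {x} {y} x∈ y∈ x≈y with ℕ.<-cmp j k
    ... | tri< j<k _ _ = New-apart-< j<k x∈ y∈ x≈y
    ... | tri≈ _ j≡k _ = j≢k j≡k
    ... | tri> _ _ k<j = New-apart-< k<j y∈ x∈ (Setoid.sym ℝ-setoid {x} {y} x≈y)

    -- Descend from `k` until the preceding set no longer contains the point; nestedness makes each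
    -- such test decidable.
    firstLevel : ∀ k {x} → S 𝒮 (suc⁺ k) x → ∃ λ j → j ℕ.≤ k × New j x
    firstLevel zero    x∈ = 0 , ℕ.z≤n , x∈
    firstLevel (suc k) x∈
      with member? (S-resp-≈ 𝒮 (suc⁺ k)) (nested _) (enum-S _) (enum-S _) x∈
    ... | no x∉   = suc k , ℕ.≤-refl , x∈ , x∉
    ... | yes x∈′ with j , j≤k , x∈New ← firstLevel k x∈′ = j , ℕ.m≤n⇒m≤1+n j≤k , x∈New

    enum-Grid : ∀ d μ → Enumeration (ℝ^ d) (Grid d μ) (gridCount d μ)
    enum-Grid zero    μ = enum-singleton [] tt λ { {[]} _ → [] }
    enum-Grid (suc d) μ = enum-⋃
      -- Pieces with different first levels are already separated by the first coordinate.
      (λ { i≢j {_ ∷ _} {_ ∷ _} (x∈ , _) (y∈ , _) (x≈y ∷ _) →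
           New-apart (i≢j ∘ Fin.toℕ-injective) x∈ y∈ x≈y })
      (λ k → enum-×̇ (enum-New (toℕ k)) (enum-Grid d (μ ∸ toℕ k)))

    -- Replacing every index by the first level of its entry can only lower the total.
    ∈-Grid⁺ : ∀ {d μ} {i : MultiIndex d} {x} → ∥ i ∥ ℕ.≤ d ℕ.+ μ → Pointwise (S 𝒮) i x →
      Grid d μ x
    ∈-Grid⁺ ∥i∥≤ [] = tt
    ∈-Grid⁺ {suc d} {μ} {mkℕ⁺ (suc k) ∷ i} {x ∷ xs} (s≤s k+∥i∥≤) (x∈ ∷ xs∈)
      with j , j≤k , x∈New ← firstLevel k x∈ =
      fromℕ< (s≤s j≤μ) ,
      subst (λ l → (New l ×̇ Grid d (μ ∸ l)) (x ∷ xs)) (sym (Fin.toℕ-fromℕ< (s≤s j≤μ)))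
        (x∈New , ∈-Grid⁺ ∥i∥≤ xs∈)
      where
      open ℕ.≤-Reasoning
      j+∥i∥≤ : j ℕ.+ ∥ i ∥ ℕ.≤ d ℕ.+ μ
      j+∥i∥≤ = ℕ.≤-trans (ℕ.+-monoˡ-≤ ∥ i ∥ j≤k) k+∥i∥≤

      -- The remaining `d` indices are positive, so they use up at least `d` of the bound `d + μ`.
      j≤μ : j ℕ.≤ μ
      j≤μ = ℕ.+-cancelʳ-≤ d j μ (begin
        j ℕ.+ d      ≤⟨ ℕ.+-monoʳ-≤ j (d≤∥i∥ i) ⟩
        j ℕ.+ ∥ i ∥  ≤⟨ j+∥i∥≤ ⟩
        d ℕ.+ μ      ≡⟨ ℕ.+-comm d μ ⟩
        μ ℕ.+ d      ∎)

      ∥i∥≤ : ∥ i ∥ ℕ.≤ d ℕ.+ (μ ∸ j)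
      ∥i∥≤ = begin
        ∥ i ∥              ≤⟨ ℕ.m+n≤o⇒m≤o∸n ∥ i ∥ (subst (ℕ._≤ d ℕ.+ μ) (ℕ.+-comm j ∥ i ∥) j+∥i∥≤) ⟩
        (d ℕ.+ μ) ∸ j      ≡⟨ ℕ.+-∸-assoc d j≤μ ⟩
        d ℕ.+ (μ ∸ j)      ∎

    -- Each entry is indexed by its own first level plus one. This gives only the upper bound on
    -- `∥ i ∥`, not the lower one that `Γ` also asks for.
    ∈-Grid⁻ : ∀ d {μ x} → Grid d μ x →
      ∃ λ (i : MultiIndex d) → ∥ i ∥ ℕ.≤ d ℕ.+ μ × Pointwise (S 𝒮) i x
    ∈-Grid⁻ zero    {x = []}    _ = [] , ℕ.z≤n , []
    ∈-Grid⁻ (suc d) {μ} {_ ∷ _} (k , x∈ , xs∈)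
      with i , ∥i∥≤ , xs∈S ← ∈-Grid⁻ d xs∈ =
      suc⁺ (toℕ k) ∷ i , s≤s (begin
        toℕ k ℕ.+ ∥ i ∥                    ≤⟨ ℕ.+-monoʳ-≤ (toℕ k) ∥i∥≤ ⟩
        toℕ k ℕ.+ (d ℕ.+ (μ ∸ toℕ k))      ≡⟨ cong (toℕ k ℕ.+_) (ℕ.+-∸-assoc d k≤μ) ⟨
        toℕ k ℕ.+ ((d ℕ.+ μ) ∸ toℕ k)      ≡⟨ ℕ.m+[n∸m]≡n (ℕ.m≤n⇒m≤o+n d k≤μ) ⟩
        d ℕ.+ μ                            ∎) ,
      New⊆S (toℕ k) x∈ ∷ xs∈S
      where
      open ℕ.≤-Reasoning
      k≤μ : toℕ k ℕ.≤ μ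
      k≤μ = Fin.toℕ≤pred[n] k

    -- For the direction from Grid to Γ, nestedness allows raising the first
    -- index until ∥ i ∥ attains its maximum, so that the lower bound holds.
    Grid⇔Γ : ∀ {d μ x} → Grid (suc d) μ x ⇔ Γ 𝒮 (suc d) μ x
    Grid⇔Γ {d} {μ} {x} = mk⇔ (raise ∘ ∈-Grid⁻ (suc d))
      (λ (_ , _ , ∥i∥≤ , x∈) → ∈-Grid⁺ ∥i∥≤ x∈)
      where
      raise : (∃ λ (i : MultiIndex (suc d)) →
                ∥ i ∥ ℕ.≤ suc d ℕ.+ μ × Pointwise (S 𝒮) i x) → Γ 𝒮 (suc d) μ x
      raise (mkℕ⁺ (suc k) ∷ i , s≤s k+∥i∥≤ , x∈ ∷ xs∈) =
        suc⁺ (d ℕ.+ μ ∸ ∥ i ∥) ∷ i ,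
        subst (suc d ℕ.⊔ suc μ ℕ.≤_) (sym ∥i′∥≡)
          (ℕ.⊔-lub (ℕ.m≤m+n (suc d) μ) (s≤s (ℕ.m≤n+m μ d))) ,
        ℕ.≤-reflexive ∥i′∥≡ ,
        S-mono (ℕ.≤⇒≤′ (ℕ.m+n≤o⇒m≤o∸n k k+∥i∥≤)) x∈ ∷ xs∈
        where
        ∥i′∥≡ : suc (d ℕ.+ μ ∸ ∥ i ∥) ℕ.+ ∥ i ∥ ≡ suc d ℕ.+ μ
        ∥i′∥≡ = cong suc (ℕ.m∸n+n≡m (ℕ.m+n≤o⇒n≤o k k+∥i∥≤))

    enum-Γ : ∀ d μ → Enumeration (ℝ^ (suc d)) (Γ 𝒮 (suc d) μ) (gridCount (suc d) μ)
    enum-Γ d μ = Enumeration-⇔ Grid⇔Γ (enum-Grid (suc d) μ)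

    gridCount-isNodeCount : IsNodeCount 𝒮 gridCount
    gridCount-isNodeCount (suc d) μ = toHasCardinality (enum-Γ d μ)

    -- Sizes of enumerated sets are unique. The case d = 0 is left out because `IsNodeCount` does
    -- not constrain it.
    IsNodeCount-unique : ∀ {N} → IsNodeCount 𝒮 N → ∀ d → .{{_ : NonZero d}} →
      genFun (N d) ≋ genFun (gridCount d)
    IsNodeCount-unique isN (suc d) μ = cong ℤ.+_ (size-unique {ℝ^ (suc d)}
      (fromHasCardinality {ℝ^ (suc d)} {Γ 𝒮 (suc d) μ} (isN (suc d) μ)) (enum-Γ d μ))

  -- Generating functions of the grid counts

  genFun-newCount : genFun newCount ≋ F 𝒮 ⊛ (𝟙 ⊖ X)
  genFun-newCount n = trans (lemma n) (⊛-comm (𝟙 ⊖ X) (F 𝒮) n)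
    where
    lemma : genFun newCount ≋ (𝟙 ⊖ X) ⊛ F 𝒮
    lemma zero    = sym (trans (ℤ.+-identityʳ _) (ℤ.*-identityˡ _))
    lemma (suc n) = begin
      ℤ.+ (f 𝒮 (suc⁺ (suc n)) ∸ f 𝒮 (suc⁺ n))
        ≡⟨ ℤ.⊖-≥ (f-mono 𝒮 (suc⁺ n) (suc⁺ (suc n)) (ℕ.n≤1+n _)) ⟨
      f 𝒮 (suc⁺ (suc n)) ℤ.⊖ f 𝒮 (suc⁺ n)
        ≡⟨ ℤ.m-n≡m⊖n (f 𝒮 (suc⁺ (suc n))) (f 𝒮 (suc⁺ n)) ⟨
      F 𝒮 (suc n) ℤ.- F 𝒮 n
        ≡⟨ [𝟙⊖X]⊛-suc (F 𝒮) n ⟨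
      ((𝟙 ⊖ X) ⊛ F 𝒮) (suc n) ∎
      where open ≡-Reasoning

  genFun-gridCount-suc : ∀ d →
    genFun (gridCount (suc d)) ≋ (F 𝒮 ⊛ (𝟙 ⊖ X)) ⊛ genFun (gridCount d)
  genFun-gridCount-suc d n = trans (genFun-⊛ newCount (gridCount d) n)
    (⊛-cong {B = genFun (gridCount d)} genFun-newCount (λ _ → refl) n)

  genFun-gridCount-1 : genFun (gridCount 1) ≋ F 𝒮
  genFun-gridCount-1 n = begin
    genFun (gridCount 1) n                            ≡⟨ genFun-gridCount-suc 0 n ⟩
    ((F 𝒮 ⊛ (𝟙 ⊖ X)) ⊛ genFun (gridCount 0)) n
      ≡⟨ ⊛-assoc (F 𝒮) (𝟙 ⊖ X) (genFun (gridCount 0)) n ⟩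
    (F 𝒮 ⊛ ((𝟙 ⊖ X) ⊛ genFun (gridCount 0))) n
      ≡⟨ ⊛-cong {F 𝒮} {B = (𝟙 ⊖ X) ⊛ genFun (gridCount 0)} (λ _ → refl) geometric n ⟩
    (F 𝒮 ⊛ 𝟙) n                                       ≡⟨ ⊛-identityʳ (F 𝒮) n ⟩
    F 𝒮 n                                             ∎
    where
    open ≡-Reasoning
    -- `gridCount 0` is constantly 1, so its series is the inverse of 1 - x.
    geometric : (𝟙 ⊖ X) ⊛ genFun (gridCount 0) ≋ 𝟙
    geometric zero    = refl
    geometric (suc n) = [𝟙⊖X]⊛-suc (genFun (gridCount 0)) n

  -- Each further dimension multiplies by D = F (1 - x), and the interchange law sends one factor to
  -- each power.
  genFun-gridCount : ∀ d → genFun (gridCount (suc d)) ≋ F 𝒮 ^ suc d ⊛ (𝟙 ⊖ X) ^ d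
  genFun-gridCount zero n = begin
    genFun (gridCount 1) n  ≡⟨ genFun-gridCount-1 n ⟩
    F 𝒮 n                   ≡⟨ ⊛-identityʳ (F 𝒮) n ⟨
    (F 𝒮 ⊛ 𝟙) n             ≡⟨ ⊛-identityʳ (F 𝒮 ⊛ 𝟙) n ⟨
    ((F 𝒮 ⊛ 𝟙) ⊛ 𝟙) n       ∎
    where open ≡-Reasoning
  genFun-gridCount (suc d) n = begin
    genFun (gridCount (suc (suc d))) n
      ≡⟨ genFun-gridCount-suc (suc d) n ⟩
    ((F 𝒮 ⊛ (𝟙 ⊖ X)) ⊛ genFun (gridCount (suc d))) n
      ≡⟨ ⊛-cong {F 𝒮 ⊛ (𝟙 ⊖ X)} (λ _ → refl) (genFun-gridCount d) n ⟩
    ((F 𝒮 ⊛ (𝟙 ⊖ X)) ⊛ (F 𝒮 ^ suc d ⊛ (𝟙 ⊖ X) ^ d)) n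
      ≡⟨ ⊛-interchange (F 𝒮) (𝟙 ⊖ X) (F 𝒮 ^ suc d) ((𝟙 ⊖ X) ^ d) n ⟩
    (F 𝒮 ^ suc (suc d) ⊛ (𝟙 ⊖ X) ^ suc d) n ∎
    where open ≡-Reasoning

-- The weighted count 𝒩

sum-map-* : ∀ {A : Set} c (g : A → ℕ) xs →
  sum (List.map (λ x → c ℕ.* g x) xs) ≡ c ℕ.* sum (List.map g xs)
sum-map-* c g []       = sym (ℕ.*-zeroʳ c)
sum-map-* c g (x ∷ xs) =
  trans (cong (c ℕ.* g x ℕ.+_) (sum-map-* c g xs)) (sym (ℕ.*-distribˡ-+ c (g x) _))

-- Stated for a general `u`, since the induction replaces `u` by `u ∘ suc`; the use is at `u` =
-- `id`, which gives `upTo`.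
sum-concatMap-applyUpTo : ∀ {A : Set} (g : A → ℕ) (φ : ℕ → List A) u n →
  sum (List.map g (concatMap φ (applyUpTo u n))) ≡
  ∑ {n} (λ k → sum (List.map g (φ (u (toℕ k)))))
sum-concatMap-applyUpTo g φ u zero    = refl
sum-concatMap-applyUpTo g φ u (suc n) = begin
  sum (List.map g (φ (u 0) List.++ xs))
    ≡⟨ cong sum (List.map-++ g (φ (u 0)) xs) ⟩
  sum (List.map g (φ (u 0)) List.++ List.map g xs)
    ≡⟨ sum-++ (List.map g (φ (u 0))) (List.map g xs) ⟩
  sum (List.map g (φ (u 0))) ℕ.+ sum (List.map g xs)
    ≡⟨ cong (_ ℕ.+_) (sum-concatMap-applyUpTo g φ (u ∘ suc) n) ⟩
  ∑ {suc n} (λ k → sum (List.map g (φ (u (toℕ k))))) ∎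
  where
  open ≡-Reasoning
  xs = concatMap φ (applyUpTo (u ∘ suc) n)

∑-cong : ∀ {n} {g h : Vector ℕ n} → (∀ i → g i ≡ h i) → ∑ g ≡ ∑ h
∑-cong {zero}  g≗h = refl
∑-cong {suc n} g≗h = cong₂ ℕ._+_ (g≗h zero) (∑-cong (g≗h ∘ suc))

module _ (𝒮 : NodeSequence) where

  weight : ∀ {d} → MultiIndex d → ℕ
  weight i = Vec.foldr′ ℕ._*_ 1 (Vec.map (f 𝒮) i)

  -- Indexed by s = `∥ i ∥`, so that `𝒩 𝒮 d μ` is the value at s = d + μ.
  totalWeight : ℕ → ℕ → ℕ
  totalWeight d s = sum (List.map weight (multiIndices d s))

  -- Group the multi-indices by their first entry `suc k`: the other entries sum to `suc s ∸ suc k`,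
  -- that is `s ∸ k`, which accounts for the shift by one on the left.
  totalWeight-suc : ∀ d s → genFun (totalWeight (suc d)) (suc s) ≡ (F 𝒮 ⊛ genFun (totalWeight d)) s
  totalWeight-suc d s = trans
    (cong ℤ.+_ (trans (sum-concatMap-applyUpTo weight block id (suc s))
      (∑-cong {suc s} (block-weight ∘ toℕ))))
    (genFun-⊛ (λ ℓ → f 𝒮 (suc⁺ ℓ)) (totalWeight d) s)
    where
    block : ℕ → List (MultiIndex (suc d))
    block k = List.map (suc⁺ k ∷_) (multiIndices d (s ∸ k))

    block-weight : ∀ k → sum (List.map weight (block k)) ≡
      f 𝒮 (suc⁺ k) ℕ.* totalWeight d (s ∸ k)
    block-weight k = trans
      (cong sum (sym (List.map-∘ (multiIndices d (s ∸ k)))))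
      (sum-map-* (f 𝒮 (suc⁺ k)) weight (multiIndices d (s ∸ k)))

  genFun-𝒩-suc : ∀ d → genFun (𝒩 𝒮 (suc d)) ≋ F 𝒮 ⊛ genFun (𝒩 𝒮 d)
  genFun-𝒩-suc d μ = trans (totalWeight-suc d (d ℕ.+ μ))
    -- Positive entries force `∥ i ∥` to be at least `d`, so the first `d` coefficients vanish.
    (⊛-shiftʳ d (F 𝒮) (genFun (totalWeight d))
      (λ s s<d → cong (λ is → ℤ.+ sum (List.map weight is)) (multiIndices-empty s<d)) μ)

  genFun-𝒩 : ∀ d → genFun (𝒩 𝒮 d) ≋ F 𝒮 ^ d
  genFun-𝒩 zero zero    = refl
  genFun-𝒩 zero (suc n) = refl
  genFun-𝒩 (suc d) n    =
    trans (genFun-𝒩-suc d n) (⊛-cong {F 𝒮} (λ _ → refl) (genFun-𝒩 d) n)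

  genFun-𝒩-1 : genFun (𝒩 𝒮 1) ≋ F 𝒮
  genFun-𝒩-1 n = trans (genFun-𝒩 1 n) (⊛-identityʳ (F 𝒮) n)

-- Both parts of the theorem from the counts computed above

theorem1p1 : (𝒮 : NodeSequence) →
    (Nested 𝒮 →
    ∃ (IsNodeCount 𝒮) ×
    ((N : ℕ → ℕ → ℕ) → IsNodeCount 𝒮 N →
    (genFun (N 1) ≋ F 𝒮) ×
    ((d : ℕ) → .{{_ : NonZero d}} →
    genFun (N d) ≋ genFun (N 1) ^ d ⊛ (𝟙 ⊖ X) ^ (d ∸ 1)))) ×
    ((genFun (𝒩 𝒮 1) ≋ F 𝒮) ×
    ((d : ℕ) → .{{_ : NonZero d}} →
    genFun (𝒩 𝒮 d) ≋ genFun (𝒩 𝒮 1) ^ d))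
theorem1p1 𝒮 = partI , genFun-𝒩-1 𝒮 ,
  λ d n → trans (genFun-𝒩 𝒮 d n) (sym (^-cong d (genFun-𝒩-1 𝒮) n))
  where
  partI : Nested 𝒮 → ∃ (IsNodeCount 𝒮) × ((N : ℕ → ℕ → ℕ) → IsNodeCount 𝒮 N →
    (genFun (N 1) ≋ F 𝒮) × ((d : ℕ) → .{{_ : NonZero d}} →
      genFun (N d) ≋ genFun (N 1) ^ d ⊛ (𝟙 ⊖ X) ^ (d ∸ 1)))
  -- The witness keeps the claim about every node count `N` from being vacuous.
  partI nested = (gridCount 𝒮 , gridCount-isNodeCount 𝒮 nested) ,
    λ N isN → N1≋F isN , power isN
    where
    module _ {N} (isN : IsNodeCount 𝒮 N) where
      N1≋F : genFun (N 1) ≋ F 𝒮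
      N1≋F n = trans (IsNodeCount-unique 𝒮 nested isN 1 n) (genFun-gridCount-1 𝒮 n)

      power : ∀ d → .{{_ : NonZero d}} → genFun (N d) ≋ genFun (N 1) ^ d ⊛ (𝟙 ⊖ X) ^ (d ∸ 1)
      power (suc d) n = begin
        genFun (N (suc d)) n                         ≡⟨ IsNodeCount-unique 𝒮 nested isN (suc d) n ⟩
        genFun (gridCount 𝒮 (suc d)) n               ≡⟨ genFun-gridCount 𝒮 d n ⟩
        (F 𝒮 ^ suc d ⊛ (𝟙 ⊖ X) ^ d) n
          ≡⟨ ⊛-cong {B = (𝟙 ⊖ X) ^ d} (^-cong (suc d) N1≋F) (λ _ → refl) n ⟨
        (genFun (N 1) ^ suc d ⊛ (𝟙 ⊖ X) ^ d) n       ∎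
        where open ≡-Reasoning
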